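{- Let $\tau$ be a countable language and let $\mathbb{K}$ be a class of $\tau$-structures closed under isomorphism. The following are equivalent: (1) $\mathbb{K}$ is both a $\mathrm{PC}_\Delta$-class and $\mathcal{L}_{\omega_1\omega}$-elementary (i.e. $\mathbb{K}$ is the class of models of some $\mathcal{L}_{\omega_1\omega}(\tau)$-sentence); (2) $\mathbb{K}$ is the class of models of some $\bigwedge\!\!\bigwedge$-sentence of $\tau$.
   Context: $\mathcal{L}_{\omega_1\omega}(\tau)$ is the infinitary logic allowing countable conjunctions $\bigwedge\!\!\bigwedge_{i\in\omega}\varphi_i$ and disjunctions $\bigvee\!\!\bigvee_{i\in\omega}\varphi_i$ of formulas (with finitely many free variables altogether), negation and finitary quantification. The $\bigwedge\!\!\bigwedge$-formulas are defined inductively: every finitary quantifier-free formula is one; if $\varphi$ is one then so are $\exists x\,\varphi$ and $\forall x\,\varphi$; if $(\varphi_i)_{i\in\omega}$ are $\bigwedge\!\!\bigwedge$-formulas with finitely many free variables in total, then $\bigwedge\!\!\bigwedge_{i\in\omega}\varphi_i$ is one. (So these are the infinitary formulas that can be written in negation normal form without infinitary disjunctions.) A class $\mathbb{K}$ of $\tau$-structures is a $\mathrm{PC}_\Delta$-class if there is a language $\tau^*\supseteq\tau$ and a first-order (finitary) $\tau^*$-theory $T$ such that $\mathbb{K}$ is exactly the class of $\tau$-structures having an expansion to a $\tau^*$-structure that is a model of $T$.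
   Formalization: In the definition of a PC_Δ-class the expanded language τ* is required to be countable; with uncountable τ* allowed, the implication from (1) to (2) is false. -}

module Defs where

open import Level using (Level; 0ℓ; _⊔_) renaming (suc to lsuc)
open import Data.Nat using (ℕ; suc)
open import Data.Fin using (Fin)
open import Data.Vec using (Vec; []; _∷_; lookup; map)
open import Data.Product using (Σ; Σ-syntax; _×_; ∃-syntax)
open import Data.Sum using (_⊎_)
open import Function.Bundles using (_⇔_; _↣_)
open import Function.Definitions using (Injective; Bijective)
open import Relation.Binary.PropositionalEquality using (_≡_)
open import Relation.Nullary using (¬_)

record Language : Set₁ where
  field
    Fun : ℕ → Set
    Rel : ℕ → Set

open Language public

-- "Countable" includes finite (and empty) sets of symbols.
CountableLanguage : Language → Set
CountableLanguage τ = (Σ ℕ (Fun τ) ↣ ℕ) × (Σ ℕ (Rel τ) ↣ ℕ)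

record Interpretation (τ : Language) (A : Set) : Set₁ where
  field
    fun : ∀ {k} → Fun τ k → Vec A k → A
    rel : ∀ {k} → Rel τ k → Vec A k → Set

-- Structures are nonempty.  The witness is not part of the language:
-- it is ignored by isomorphisms and by satisfaction.
record Structure (τ : Language) : Set₁ where
  field
    Carrier        : Set
    inhabitant     : Carrier
    interpretation : Interpretation τ Carrier
  open Interpretation interpretation public

record _≅_ {τ : Language} (M N : Structure τ) : Set where
  private
    module M = Structure M
    module N = Structure N
  field
    to        : M.Carrier → N.Carrier
    bijective : Bijective _≡_ _≡_ to
    fun-hom   : ∀ {k} (f : Fun τ k) xs → to (M.fun f xs) ≡ N.fun f (map to xs)
    rel-hom   : ∀ {k} (R : Rel τ k) xs → M.rel R xs ⇔ N.rel R (map to xs)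

-- Terms and formulas are well scoped: n bounds the free variables, which
-- are de Bruijn indices, so infinitary connectives only apply to families
-- with finitely many free variables altogether.

data Term (τ : Language) (n : ℕ) : Set where
  var : Fin n → Term τ n
  app : ∀ {k} → Fun τ k → Vec (Term τ n) k → Term τ n

-- The formulas of L_{ω₁ω}(τ).  The binary connectives are kept alongside ⋀ and
-- ⋁ so that finitary formulas are literally among the infinitary ones.
data Formula (τ : Language) (n : ℕ) : Set where
  _≈_     : Term τ n → Term τ n → Formula τ n
  rel     : ∀ {k} → Rel τ k → Vec (Term τ n) k → Formula τ n
  neg     : Formula τ n → Formula τ n
  _∧_ _∨_ : Formula τ n → Formula τ n → Formula τ n
  ex all  : Formula τ (suc n) → Formula τ n
  ⋀ ⋁     : (ℕ → Formula τ n) → Formula τ n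

Sentence : Language → Set
Sentence τ = Formula τ 0

data FirstOrder {τ : Language} {n : ℕ} : Formula τ n → Set where
  eq   : ∀ s t → FirstOrder (s ≈ t)
  rel  : ∀ {k} (R : Rel τ k) ts → FirstOrder (rel R ts)
  neg  : ∀ {φ} → FirstOrder φ → FirstOrder (neg φ)
  and  : ∀ {φ ψ} → FirstOrder φ → FirstOrder ψ → FirstOrder (φ ∧ ψ)
  or   : ∀ {φ ψ} → FirstOrder φ → FirstOrder ψ → FirstOrder (φ ∨ ψ)
  ex   : ∀ {φ} → FirstOrder φ → FirstOrder (ex φ)
  all  : ∀ {φ} → FirstOrder φ → FirstOrder (all φ)

data FinitaryQuantifierFree {τ : Language} {n : ℕ} : Formula τ n → Set where
  eq   : ∀ s t → FinitaryQuantifierFree (s ≈ t)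
  rel  : ∀ {k} (R : Rel τ k) ts → FinitaryQuantifierFree (rel R ts)
  neg  : ∀ {φ} → FinitaryQuantifierFree φ → FinitaryQuantifierFree (neg φ)
  and  : ∀ {φ ψ} → FinitaryQuantifierFree φ → FinitaryQuantifierFree ψ →
         FinitaryQuantifierFree (φ ∧ ψ)
  or   : ∀ {φ ψ} → FinitaryQuantifierFree φ → FinitaryQuantifierFree ψ →
         FinitaryQuantifierFree (φ ∨ ψ)

data IsBigAnd {τ : Language} {n : ℕ} : Formula τ n → Set where
  qf  : ∀ {φ} → FinitaryQuantifierFree φ → IsBigAnd φ
  ex  : ∀ {φ} → IsBigAnd φ → IsBigAnd (ex φ)
  all : ∀ {φ} → IsBigAnd φ → IsBigAnd (all φ)
  ⋀   : ∀ {φs} → (∀ i → IsBigAnd (φs i)) → IsBigAnd (⋀ φs)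

module _ {τ : Language} {A : Set} (I : Interpretation τ A) where
  private module I = Interpretation I

  mutual
    eval : ∀ {n} → Vec A n → Term τ n → A
    eval ρ (var i)    = lookup ρ i
    eval ρ (app f ts) = I.fun f (evals ρ ts)

    evals : ∀ {n k} → Vec A n → Vec (Term τ n) k → Vec A k
    evals ρ []       = []
    evals ρ (t ∷ ts) = eval ρ t ∷ evals ρ ts

  Sat : ∀ {n} → Vec A n → Formula τ n → Set
  Sat ρ (s ≈ t)    = eval ρ s ≡ eval ρ t
  Sat ρ (rel R ts) = I.rel R (evals ρ ts)
  Sat ρ (neg φ)    = ¬ Sat ρ φ
  Sat ρ (φ ∧ ψ)    = Sat ρ φ × Sat ρ ψ
  Sat ρ (φ ∨ ψ)    = Sat ρ φ ⊎ Sat ρ ψ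
  Sat ρ (ex φ)     = ∃[ a ] Sat (a ∷ ρ) φ
  Sat ρ (all φ)    = ∀ a → Sat (a ∷ ρ) φ
  Sat ρ (⋀ φs)     = ∀ i → Sat ρ (φs i)
  Sat ρ (⋁ φs)     = ∃[ i ] Sat ρ (φs i)

infix 4 _⊨_

_⊨_ : ∀ {τ} → Structure τ → Sentence τ → Set
M ⊨ φ = Sat (Structure.interpretation M) [] φ

record _⊆ᴸ_ (τ τ* : Language) : Set where
  field
    onFun           : ∀ {k} → Fun τ k → Fun τ* k
    onRel           : ∀ {k} → Rel τ k → Rel τ* k
    onFun-injective : ∀ {k} → Injective _≡_ _≡_ (onFun {k})
    onRel-injective : ∀ {k} → Injective _≡_ _≡_ (onRel {k})

-- An expansion of M keeps its carrier, so it is an interpretation of τ* there.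
-- Relations are Set-valued and hence compared up to logical equivalence.
record Expansion {τ τ* : Language} (ι : τ ⊆ᴸ τ*) (M : Structure τ) : Set₁ where
  private
    module M = Structure M
    module ι = _⊆ᴸ_ ι
  field
    interpretation* : Interpretation τ* M.Carrier
  open Interpretation interpretation*
    renaming (fun to fun*; rel to rel*) public
  field
    fun-agrees : ∀ {k} (f : Fun τ k) xs → fun* (ι.onFun f) xs ≡ M.fun f xs
    rel-agrees : ∀ {k} (R : Rel τ k) xs → rel* (ι.onRel R) xs ⇔ M.rel R xs

  structure* : Structure τ*
  structure* = record
    { Carrier        = M.Carrier
    ; inhabitant     = M.inhabitant
    ; interpretation = interpretation*
    }

record FirstOrderTheory (τ : Language) : Set₁ where
  field
    Axiom      : Sentence τ → Set
    firstOrder : ∀ {φ} → Axiom φ → FirstOrder φ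

_⊨ᵀ_ : ∀ {τ} → Structure τ → FirstOrderTheory τ → Set
M ⊨ᵀ T = ∀ φ → FirstOrderTheory.Axiom T φ → M ⊨ φ

module _ {ℓ : Level} {τ : Language} (K : Structure τ → Set ℓ) where

  ClosedUnderIsomorphism : Set (lsuc 0ℓ ⊔ ℓ)
  ClosedUnderIsomorphism = ∀ {M N} → M ≅ N → K M → K N

  -- All languages are countable, the expanded language τ* included.  This is
  -- not automatic: with uncountably many new symbols one can axiomatise
  -- intersections of uncountably many classes of models of ⋀-sentences, and
  -- such an intersection can be L_{ω₁ω}-elementary without being the class of
  -- models of a single ⋀-sentence.
  IsPCΔ : Set (lsuc 0ℓ ⊔ ℓ)
  IsPCΔ = Σ[ τ* ∈ Language ] CountableLanguage τ* ×
          (Σ[ ι ∈ τ ⊆ᴸ τ* ] Σ[ T ∈ FirstOrderTheory τ* ]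
           (∀ M → K M ⇔ (Σ[ E ∈ Expansion ι M ] Expansion.structure* E ⊨ᵀ T)))

  IsInfinitaryElementary : Set (lsuc 0ℓ ⊔ ℓ)
  IsInfinitaryElementary = Σ[ φ ∈ Sentence τ ] (∀ M → K M ⇔ M ⊨ φ)

  IsBigAndElementary : Set (lsuc 0ℓ ⊔ ℓ)
  IsBigAndElementary = Σ[ φ ∈ Sentence τ ] IsBigAnd φ × (∀ M → K M ⇔ M ⊨ φ)

module Submission where

-- (1) ⇒ (2) is an interpolation theorem: if a first-order theory T of a larger language
-- entails an L_{ω₁ω}(τ)-sentence φ, then T ⊨ θ and θ ⊨ φ for some ⋀-sentence θ of τ.
-- Otherwise shrink, step by step, the class C of all assignments of the constants
-- 0, 1, 2, … in models of T and the class D of all assignments in models of ¬ φ, never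
-- letting a ⋀-formula in the constants used so far separate C from D.  First-order
-- formulas only ever require C to be split into two cases, where separators θ₀, θ₁ of
-- the cases yield ∃ (θ₀ ∨ θ₁); the subformulas of φ require D to be split into countably
-- many cases, where separators yield ∀ ⋀ᵢ θᵢ.  In the limit C and D agree on the atomic
-- formulas of τ, so that both describe one structure, made of the constants, which is a
-- model of T and of ¬ φ.
--
-- For (2) ⇒ (1) name every subformula of the ⋀-sentence by a new relation symbol.  It is
-- enough that each name implies what its formula says about the names of the immediate
-- subformulas, and in this direction an infinitary conjunction becomes infinitely many
-- first-order axioms.

open import Defs
open import Axiom.ExcludedMiddle using (ExcludedMiddle)
open import Data.Empty using (⊥; ⊥-elim)
open import Data.Fin using (Fin; zero; suc; toℕ; fromℕ<; lift)
open import Data.Fin.Properties using (toℕ-injective; toℕ-fromℕ<)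
open import Data.List using (List; []; _∷_; foldl; foldr)
open import Data.Nat using (ℕ; zero; suc; _+_; _≤_; _<_; _≤′_; ≤′-refl; ≤′-step; z≤n; s≤s; _⊔_)
open import Data.Nat.Properties
  using (+-suc; +-identityʳ; suc-injective; _≟_; ≤-refl; ≤-trans; <-irrefl; <-≤-trans; ≤-antisym; n≤1+n; n<1+n;
         m<n⇒m<1+n; m≤m⊔n; m≤n⊔m; m<1+n⇒m<n∨m≡n; ≤⇒≤′; ≡-irrelevant)
open import Data.Product using (Σ; Σ-syntax; _×_; _,_; proj₁; proj₂; ∃; ∃-syntax)
open import Data.Product.Function.NonDependent.Propositional using (_×-⇔_)
open import Data.Product.Properties using (,-injectiveˡ; ,-injectiveʳ)
open import Data.Sum using (_⊎_; inj₁; inj₂; swap)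
open import Data.Sum.Properties using (inj₁-injective)
open import Data.Sum.Function.Propositional using (_⊎-⇔_)
open import Data.Vec using (Vec; []; _∷_; allFin; lookup; map; tabulate; toList; fromList)
open import Data.Vec.Properties using (lookup-map; map-lookup-allFin; tabulate-∘; tabulate∘lookup; toList∘fromList)
open import Function using (_∘_; id; flip; case_of_)
open import Function.Bundles using (_⇔_; _↠_; mk⇔; mk↣; mk↠ₛ; Equivalence; Injection; Surjection)
open import Function.Construct.Composition using (_↠-∘_; _⇔-∘_)
open import Function.Construct.Identity using (⇔-id; ↠-id)
open import Relation.Binary.PropositionalEquality using (_≡_; refl; sym; trans; cong; cong₂; subst)
open import Relation.Nullary using (¬_; Dec; yes; no)
open import Relation.Nullary.Decidable using (True; toWitness; fromWitness)

-- Enumerations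

successor : ℕ × ℕ → ℕ × ℕ
successor (zero  , b) = suc b , 0
successor (suc a , b) = a , suc b

-- Runs through the diagonals a + b = 0, 1, 2, ….
unpair : ℕ → ℕ × ℕ
unpair zero    = 0 , 0
unpair (suc n) = successor (unpair n)

pairs : ℕ ↠ (ℕ × ℕ)
pairs = mk↠ₛ {to = unpair} λ (a , b) → onDiagonal (a + b) b a refl
  where
  step : ∀ {x} → ∃[ n ] unpair n ≡ x → ∃[ n ] unpair n ≡ successor x
  step (n , p) = suc n , cong successor p

  -- Induction on the diagonal `s`, then on `b`: the predecessor of a pair with `b > 0` lies on the
  -- same diagonal, that of `(suc a , 0)` is the end of the previous one.
  onDiagonal : ∀ s b a → a + b ≡ s → ∃[ n ] unpair n ≡ (a , b)
  onDiagonal s       (suc b) a       p = step (onDiagonal s b (suc a) (trans (sym (+-suc a b)) p))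
  onDiagonal s       zero    zero    p = 0 , refl
  onDiagonal (suc s) zero    (suc a) p =
    step (onDiagonal s a 0 (trans (sym (+-identityʳ a)) (suc-injective p)))

∐ : ∀ {A : Set} {B : A → Set} → ℕ ↠ A → (∀ x → ℕ ↠ B x) → ℕ ↠ Σ A B
∐ {A} {B} f g = mk↠ₛ {to = to} surjective ↠-∘ pairs
  where
  to : ℕ × ℕ → Σ A B
  to (m , n) = Surjection.to f m , Surjection.to (g (Surjection.to f m)) n

  surjective : ∀ z → ∃[ p ] to p ≡ z
  surjective (x , y) with m , refl ← Surjection.strictlySurjective f x
    with n , refl ← Surjection.strictlySurjective (g x) y = (m , n) , refl

_⊗_ : ∀ {A B : Set} → ℕ ↠ A → ℕ ↠ B → ℕ ↠ (A × B)
f ⊗ g = ∐ f (λ _ → g)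

vectors : ∀ k → ℕ ↠ Vec ℕ k
vectors zero    = mk↠ₛ {to = λ _ → []} λ { [] → 0 , refl }
vectors (suc k) = mk↠ₛ {to = λ (x , xs) → x ∷ xs} (λ { (x ∷ xs) → (x , xs) , refl }) ↠-∘ (↠-id ℕ ⊗ vectors k)

lists : ℕ ↠ List ℕ
lists = mk↠ₛ {to = λ (_ , xs) → toList xs} (λ xs → (_ , fromList xs) , toList∘fromList xs) ↠-∘ ∐ (↠-id ℕ) vectors

abstract
  encode : ∀ {A : Set} → ℕ ↠ A → A → ℕ
  encode f x = proj₁ (Surjection.strictlySurjective f x)

  -- A section of a surjection is injective; this turns enumerations into codes.
  encode-injective : ∀ {A : Set} (f : ℕ ↠ A) {x y} → encode f x ≡ encode f y → x ≡ y
  encode-injective f {x} {y} p = trans (sym (proj₂ (Surjection.strictlySurjective f x)))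
    (trans (cong (Surjection.to f) p) (proj₂ (Surjection.strictlySurjective f y)))

-- Codes of first-order formulas

module Serialisation {τ : Language} (countable : CountableLanguage τ) where

  private
    module FunCode = Injection (proj₁ countable)
    module RelCode = Injection (proj₂ countable)

  -- Polish notation: ReadsTerm l t r says that l consists of the code of t followed by r.
  mutual
    data ReadsTerm {n} : List ℕ → Term τ n → List ℕ → Set where
      var : ∀ {i c l} → toℕ i ≡ c → ReadsTerm (0 ∷ c ∷ l) (var i) l
      app : ∀ {k} {f : Fun τ k} {ts c l r} → FunCode.to (k , f) ≡ c → ReadsTerms l ts r →
            ReadsTerm (1 ∷ c ∷ l) (app f ts) r

    data ReadsTerms {n} : ∀ {k} → List ℕ → Vec (Term τ n) k → List ℕ → Set where
      []  : ∀ {l} → ReadsTerms l [] l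
      _∷_ : ∀ {k t l m r} {ts : Vec _ k} → ReadsTerm l t m → ReadsTerms m ts r → ReadsTerms l (t ∷ ts) r

  -- A formula is read together with its evidence of being first-order, so that unique reading
  -- determines this evidence as well.
  data Reads {n} : List ℕ → ∃ (FirstOrder {τ} {n}) → List ℕ → Set where
    eq  : ∀ {s t l m r} → ReadsTerm l s m → ReadsTerm m t r → Reads (0 ∷ l) (s ≈ t , eq s t) r
    rel : ∀ {k} {R : Rel τ k} {ts c l r} → RelCode.to (k , R) ≡ c → ReadsTerms l ts r →
          Reads (1 ∷ c ∷ l) (rel R ts , rel R ts) r
    neg : ∀ {φ a l r} → Reads l (φ , a) r → Reads (2 ∷ l) (neg φ , neg a) r
    and : ∀ {φ a ψ b l m r} → Reads l (φ , a) m → Reads m (ψ , b) r → Reads (3 ∷ l) (φ ∧ ψ , and a b) r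
    or  : ∀ {φ a ψ b l m r} → Reads l (φ , a) m → Reads m (ψ , b) r → Reads (4 ∷ l) (φ ∨ ψ , or a b) r
    ex  : ∀ {φ a l r} → Reads l (φ , a) r → Reads (5 ∷ l) (ex φ , ex a) r
    all : ∀ {φ a l r} → Reads l (φ , a) r → Reads (6 ∷ l) (all φ , all a) r

  mutual
    -- The code of a symbol determines its arity and hence how many terms must follow, so neither
    -- brackets nor lengths are coded.
    readTerm-unique : ∀ {n l r r′} {t t′ : Term τ n} → ReadsTerm l t r → ReadsTerm l t′ r′ → t ≡ t′ × r ≡ r′
    readTerm-unique (var p)    (var q)    = cong var (toℕ-injective (trans p (sym q))) , refl
    readTerm-unique (app p xs) (app q ys) with refl ← FunCode.injective (trans p (sym q))
      with refl , refl ← readTerms-unique xs ys = refl , refl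

    readTerms-unique : ∀ {n k l r r′} {ts ts′ : Vec (Term τ n) k} →
                       ReadsTerms l ts r → ReadsTerms l ts′ r′ → ts ≡ ts′ × r ≡ r′
    readTerms-unique []       []       = refl , refl
    readTerms-unique (x ∷ xs) (y ∷ ys) with refl , refl ← readTerm-unique x y
      with refl , refl ← readTerms-unique xs ys = refl , refl

  read-unique : ∀ {n l r r′} {φ φ′ : ∃ (FirstOrder {τ} {n})} → Reads l φ r → Reads l φ′ r′ → φ ≡ φ′ × r ≡ r′
  read-unique (eq x y) (eq x′ y′) with refl , refl ← readTerm-unique x x′
    with refl , refl ← readTerm-unique y y′ = refl , refl
  read-unique (rel p xs) (rel q ys) with refl ← RelCode.injective (trans p (sym q))
    with refl , refl ← readTerms-unique xs ys = refl , refl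
  read-unique (neg x) (neg y) with refl , refl ← read-unique x y = refl , refl
  read-unique (and x y) (and x′ y′) with refl , refl ← read-unique x x′
    with refl , refl ← read-unique y y′ = refl , refl
  read-unique (or x y) (or x′ y′) with refl , refl ← read-unique x x′
    with refl , refl ← read-unique y y′ = refl , refl
  read-unique (ex x) (ex y) with refl , refl ← read-unique x y = refl , refl
  read-unique (all x) (all y) with refl , refl ← read-unique x y = refl , refl

  mutual
    writeTerm : ∀ {n} (t : Term τ n) r → ∃[ l ] ReadsTerm l t r
    writeTerm (var i)    r = _ , var refl
    writeTerm (app f ts) r = _ , app refl (proj₂ (writeTerms ts r))

    writeTerms : ∀ {n k} (ts : Vec (Term τ n) k) r → ∃[ l ] ReadsTerms l ts r
    writeTerms []       r = _ , []
    writeTerms (t ∷ ts) r = _ , proj₂ (writeTerm t _) ∷ proj₂ (writeTerms ts r)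

  write : ∀ {n} {φ : Formula τ n} (a : FirstOrder φ) r → ∃[ l ] Reads l (φ , a) r
  write (eq s t)   r = _ , eq (proj₂ (writeTerm s _)) (proj₂ (writeTerm t r))
  write (rel R ts) r = _ , rel refl (proj₂ (writeTerms ts r))
  write (neg a)    r = _ , neg (proj₂ (write a r))
  write (and a b)  r = _ , and (proj₂ (write a _)) (proj₂ (write b r))
  write (or a b)   r = _ , or (proj₂ (write a _)) (proj₂ (write b r))
  write (ex a)     r = _ , ex (proj₂ (write a r))
  write (all a)    r = _ , all (proj₂ (write a r))

  firstOrderFormulas : ExcludedMiddle _ → ∀ n → ℕ ↠ ∃ (FirstOrder {τ} {n})
  firstOrderFormulas em n = mk↠ₛ {to = λ l → decode (em {∃ λ x → Reads {n} l x []})} surjective ↠-∘ lists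
    where
    decode : ∀ {l} → Dec (∃ λ x → Reads {n} l x []) → ∃ (FirstOrder {τ} {n})
    decode (yes (x , _)) = x
    -- Lists that code nothing go to an arbitrary first-order formula.
    decode (no _)        = ex (var zero ≈ var zero) , ex (eq _ _)

    surjective : ∀ x → ∃[ l ] decode (em {∃ λ x → Reads {n} l x []}) ≡ x
    surjective (φ , a) = l , lemma em
      where
      l : List ℕ
      l = proj₁ (write a [])
      lemma : (d : Dec (∃ λ x → Reads {n} l x [])) → decode d ≡ (φ , a)
      lemma (yes (x , p)) = proj₁ (read-unique p (proj₂ (write a [])))
      lemma (no ¬p)       = ⊥-elim (¬p (_ , proj₂ (write a [])))

-- Formulas along expansions

module Renaming {τ τ* : Language} (ι : τ ⊆ᴸ τ*) where
  private module ι = _⊆ᴸ_ ι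

  mutual
    renameTerm : ∀ {m n} → (Fin m → Fin n) → Term τ m → Term τ* n
    renameTerm r (var i)    = var (r i)
    renameTerm r (app f ts) = app (ι.onFun f) (renameTerms r ts)

    renameTerms : ∀ {m n k} → (Fin m → Fin n) → Vec (Term τ m) k → Vec (Term τ* n) k
    renameTerms r []       = []
    renameTerms r (t ∷ ts) = renameTerm r t ∷ renameTerms r ts

  -- Moves symbols along `ι` and variables along `r` at once: over `⊆ᴸ-refl` it only changes
  -- variables, and with `r = id` it only translates the language.
  rename : ∀ {m n} → (Fin m → Fin n) → Formula τ m → Formula τ* n
  rename r (s ≈ t)    = renameTerm r s ≈ renameTerm r t
  rename r (rel R ts) = rel (ι.onRel R) (renameTerms r ts)
  rename r (neg φ)    = neg (rename r φ)
  rename r (φ ∧ ψ)    = rename r φ ∧ rename r ψ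
  rename r (φ ∨ ψ)    = rename r φ ∨ rename r ψ
  rename r (ex φ)     = ex (rename (lift 1 r) φ)
  rename r (all φ)    = all (rename (lift 1 r) φ)
  rename r (⋀ φs)     = ⋀ (λ i → rename r (φs i))
  rename r (⋁ φs)     = ⋁ (λ i → rename r (φs i))

  rename-quantifierFree : ∀ {m n} (r : Fin m → Fin n) {φ} →
                          FinitaryQuantifierFree φ → FinitaryQuantifierFree (rename r φ)
  rename-quantifierFree r (eq s t)   = eq _ _
  rename-quantifierFree r (rel R ts) = rel _ _
  rename-quantifierFree r (neg a)    = neg (rename-quantifierFree r a)
  rename-quantifierFree r (and a b)  = and (rename-quantifierFree r a) (rename-quantifierFree r b)
  rename-quantifierFree r (or a b)   = or (rename-quantifierFree r a) (rename-quantifierFree r b)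

  rename-isBigAnd : ∀ {m n} (r : Fin m → Fin n) {φ} → IsBigAnd φ → IsBigAnd (rename r φ)
  rename-isBigAnd r (qf a)  = qf (rename-quantifierFree r a)
  rename-isBigAnd r (ex a)  = ex (rename-isBigAnd (lift 1 r) a)
  rename-isBigAnd r (all a) = all (rename-isBigAnd (lift 1 r) a)
  rename-isBigAnd r (⋀ as)  = ⋀ (λ i → rename-isBigAnd r (as i))

  module _ {M : Structure τ} (E : Expansion ι M) where
    private
      module M = Structure M
      module E = Expansion E

    mutual
      eval-rename : ∀ {m n} {r : Fin m → Fin n} {ρ* ρ} → (∀ i → lookup ρ* (r i) ≡ lookup ρ i) →
                    ∀ t → eval E.interpretation* ρ* (renameTerm r t) ≡ eval M.interpretation ρ t
      eval-rename h (var i)    = h i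
      eval-rename h (app f ts) =
        trans (cong (E.fun* (ι.onFun f)) (evals-rename h ts)) (E.fun-agrees f _)

      evals-rename : ∀ {m n k} {r : Fin m → Fin n} {ρ* ρ} → (∀ i → lookup ρ* (r i) ≡ lookup ρ i) →
                     (ts : Vec (Term τ m) k) →
                     evals E.interpretation* ρ* (renameTerms r ts) ≡ evals M.interpretation ρ ts
      evals-rename h []       = refl
      evals-rename h (t ∷ ts) = cong₂ _∷_ (eval-rename h t) (evals-rename h ts)

    lookup-lift : ∀ {m n} {r : Fin m → Fin n} {ρ* ρ} → (∀ i → lookup ρ* (r i) ≡ lookup ρ i) →
                  ∀ (a : M.Carrier) i → lookup (a ∷ ρ*) (lift 1 r i) ≡ lookup (a ∷ ρ) i
    lookup-lift h a zero    = refl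
    lookup-lift h a (suc i) = h i

    Sat-rename : ∀ {m n} {r : Fin m → Fin n} {ρ* ρ} → (∀ i → lookup ρ* (r i) ≡ lookup ρ i) →
                 ∀ φ → Sat E.interpretation* ρ* (rename r φ) ⇔ Sat M.interpretation ρ φ
    Sat-rename {ρ* = ρ*} {ρ} h (s ≈ t)
      rewrite eval-rename {ρ* = ρ*} {ρ} h s | eval-rename {ρ* = ρ*} {ρ} h t = ⇔-id _
    Sat-rename {ρ* = ρ*} {ρ} h (rel R ts) rewrite evals-rename {ρ* = ρ*} {ρ} h ts = E.rel-agrees R _
    Sat-rename h (neg φ) =
      mk⇔ (_∘ Equivalence.from (Sat-rename h φ)) (_∘ Equivalence.to (Sat-rename h φ))
    Sat-rename h (φ ∧ ψ) = Sat-rename h φ ×-⇔ Sat-rename h ψ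
    Sat-rename h (φ ∨ ψ) = Sat-rename h φ ⊎-⇔ Sat-rename h ψ
    Sat-rename h (ex φ) =
      mk⇔ (λ (a , x) → a , Equivalence.to (Sat-rename (lookup-lift h a) φ) x)
          (λ (a , x) → a , Equivalence.from (Sat-rename (lookup-lift h a) φ) x)
    Sat-rename h (all φ) =
      mk⇔ (λ x a → Equivalence.to (Sat-rename (lookup-lift h a) φ) (x a))
          (λ x a → Equivalence.from (Sat-rename (lookup-lift h a) φ) (x a))
    Sat-rename h (⋀ φs) =
      mk⇔ (λ x i → Equivalence.to (Sat-rename h (φs i)) (x i))
          (λ x i → Equivalence.from (Sat-rename h (φs i)) (x i))
    Sat-rename h (⋁ φs) =
      mk⇔ (λ (i , x) → i , Equivalence.to (Sat-rename h (φs i)) x)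
          (λ (i , x) → i , Equivalence.from (Sat-rename h (φs i)) x)

    Sat-translate : ∀ {n} ρ (φ : Formula τ n) → Sat E.interpretation* ρ (rename id φ) ⇔ Sat M.interpretation ρ φ
    Sat-translate ρ = Sat-rename {ρ* = ρ} {ρ} λ _ → refl

-- Satisfaction, reducts and weakening

firstOrder : ∀ {τ n} {φ : Formula τ n} → FinitaryQuantifierFree φ → FirstOrder φ
firstOrder (eq s t)   = eq s t
firstOrder (rel R ts) = rel R ts
firstOrder (neg a)    = neg (firstOrder a)
firstOrder (and a b)  = and (firstOrder a) (firstOrder b)
firstOrder (or a b)   = or (firstOrder a) (firstOrder b)

infix 4 _[_]⊨_
_[_]⊨_ : ∀ {τ n} (M : Structure τ) → Vec (Structure.Carrier M) n → Formula τ n → Set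
M [ ρ ]⊨ φ = Sat (Structure.interpretation M) ρ φ

evals-var : ∀ {τ n k} {A : Set} (I : Interpretation τ A) (ρ : Vec A n) (is : Vec (Fin n) k) →
            evals I ρ (map var is) ≡ map (lookup ρ) is
evals-var I ρ []       = refl
evals-var I ρ (i ∷ is) = cong (lookup ρ i ∷_) (evals-var I ρ is)

-- For formulas that apply `f` to the variables 1, 2, ... while variable 0 stands for the value of
-- `f`.
evals-shifted : ∀ {τ n} {A : Set} (I : Interpretation τ A) y (ρ : Vec A n) →
                evals I (y ∷ ρ) (map var (tabulate suc)) ≡ ρ
evals-shifted I y ρ = trans (evals-var I (y ∷ ρ) (tabulate suc))
  (trans (sym (tabulate-∘ (lookup (y ∷ ρ)) suc)) (tabulate∘lookup ρ))

¬∀⇒∃¬ : (∀ {a} → ExcludedMiddle a) → ∀ {a} {I : Set} {P : I → Set a} → ¬ (∀ i → P i) → ∃[ i ] ¬ P i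
¬∀⇒∃¬ em {P = P} h with em {P = ∃[ i ] ¬ P i}
... | yes e = e
... | no ¬e = ⊥-elim (h λ i → case em {P = P i} of λ where
  (yes p) → p
  (no ¬p) → ⊥-elim (¬e (i , ¬p)))

⊆ᴸ-refl : ∀ {τ} → τ ⊆ᴸ τ
⊆ᴸ-refl = record { onFun = id ; onRel = id ; onFun-injective = id ; onRel-injective = id }

trivialExpansion : ∀ {τ} (M : Structure τ) → Expansion ⊆ᴸ-refl M
trivialExpansion M = record
  { interpretation* = Structure.interpretation M
  ; fun-agrees      = λ _ _ → refl
  ; rel-agrees      = λ _ _ → ⇔-id _
  }

reduct : ∀ {τ τ*} → τ ⊆ᴸ τ* → Structure τ* → Structure τ
reduct ι N = record
  { Carrier        = Structure.Carrier N
  ; inhabitant     = Structure.inhabitant N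
  ; interpretation = record
    { fun = λ f → Structure.fun N (_⊆ᴸ_.onFun ι f)
    ; rel = λ R → Structure.rel N (_⊆ᴸ_.onRel ι R)
    }
  }

reductExpansion : ∀ {τ τ*} (ι : τ ⊆ᴸ τ*) (N : Structure τ*) → Expansion ι (reduct ι N)
reductExpansion ι N = record
  { interpretation* = Structure.interpretation N
  ; fun-agrees      = λ _ _ → refl
  ; rel-agrees      = λ _ _ → ⇔-id _
  }

weaken : ∀ {τ n} → Formula τ n → Formula τ (suc n)
weaken = Renaming.rename ⊆ᴸ-refl suc

Sat-weaken : ∀ {τ n} (M : Structure τ) a {ρ} (φ : Formula τ n) → M [ a ∷ ρ ]⊨ weaken φ ⇔ M [ ρ ]⊨ φ
Sat-weaken M a φ = Renaming.Sat-rename ⊆ᴸ-refl (trivialExpansion M) (λ _ → refl) φ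

-- The quantifier provides a term even when there are no free variables and no constant symbols;
-- `verum` is true because structures are nonempty.
falsum verum : ∀ {τ n} → Formula τ n
falsum = ex (neg (var zero ≈ var zero))
verum  = ex (var zero ≈ var zero)

-- Finite disjunctions of ⋀-formulas

module Disjunction (em : ∀ {a} → ExcludedMiddle a) {τ : Language} where

  _IsDisjunctionOf_,_ : ∀ {n} → Formula τ n → Formula τ n → Formula τ n → Set₁
  θ IsDisjunctionOf φ , ψ = ∀ M ρ → M [ ρ ]⊨ θ ⇔ (M [ ρ ]⊨ φ ⊎ M [ ρ ]⊨ ψ)

  BigAndDisjunction : ∀ {n} → Formula τ n → Formula τ n → Set₁
  BigAndDisjunction φ ψ = Σ[ θ ∈ Formula τ _ ] IsBigAnd θ × θ IsDisjunctionOf φ , ψ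

  -- Two rounds are needed, one for the quantifiers and conjunctions of each disjunct.
  pull : (G : ∀ {n} → Formula τ n → Set) → (∀ {n} {ψ : Formula τ n} → G ψ → G (weaken ψ)) →
         (∀ {n} {φ ψ : Formula τ n} → FinitaryQuantifierFree φ → G ψ → BigAndDisjunction φ ψ) →
         ∀ {n} {φ ψ : Formula τ n} → IsBigAnd φ → G ψ → BigAndDisjunction φ ψ
  pull G G-weaken base = go
    where
    go : ∀ {n} {φ ψ : Formula τ n} → IsBigAnd φ → G ψ → BigAndDisjunction φ ψ
    go (qf a) g = base a g
    go {ψ = ψ} (ex a) g with θ , b , h ← go a (G-weaken g) = ex θ , ex b , λ M ρ → mk⇔
      (λ (x , s) → case (Equivalence.to (h M (x ∷ ρ)) s) of λ where
         (inj₁ u) → inj₁ (x , u)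
         (inj₂ v) → inj₂ (Equivalence.to (Sat-weaken M x ψ) v))
      λ where
         (inj₁ (x , u)) → x , Equivalence.from (h M (x ∷ ρ)) (inj₁ u)
         -- `ψ` does not mention the new variable, so any element of the nonempty carrier is a
         -- witness.
         (inj₂ v) → let x = Structure.inhabitant M in
                    x , Equivalence.from (h M (x ∷ ρ)) (inj₂ (Equivalence.from (Sat-weaken M x ψ) v))
    go {ψ = ψ} (all a) g with θ , b , h ← go a (G-weaken g) = all θ , all b , λ M ρ → mk⇔
      -- Deciding `ψ` first is what lets it move out of the scope of the quantifier.
      (λ s → case em {P = M [ ρ ]⊨ ψ} of λ where
         (yes v) → inj₂ v
         (no ¬v) → inj₁ λ x → case Equivalence.to (h M (x ∷ ρ)) (s x) of λ where
           (inj₁ u) → u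
           (inj₂ v) → ⊥-elim (¬v (Equivalence.to (Sat-weaken M x ψ) v)))
      λ where
         (inj₁ u) x → Equivalence.from (h M (x ∷ ρ)) (inj₁ (u x))
         (inj₂ v) x → Equivalence.from (h M (x ∷ ρ)) (inj₂ (Equivalence.from (Sat-weaken M x ψ) v))
    go {ψ = ψ} (⋀ as) g = ⋀ (λ i → proj₁ (go (as i) g)) , ⋀ (λ i → proj₁ (proj₂ (go (as i) g))) , λ M ρ → mk⇔
      (λ s → case em {P = M [ ρ ]⊨ ψ} of λ where
         (yes v) → inj₂ v
         (no ¬v) → inj₁ λ i → case Equivalence.to (proj₂ (proj₂ (go (as i) g)) M ρ) (s i) of λ where
           (inj₁ u) → u
           (inj₂ v) → ⊥-elim (¬v v))
      λ where
         (inj₁ u) i → Equivalence.from (proj₂ (proj₂ (go (as i) g)) M ρ) (inj₁ (u i))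
         (inj₂ v) i → Equivalence.from (proj₂ (proj₂ (go (as i) g)) M ρ) (inj₂ v)

  disjunction : ∀ {n} {φ ψ : Formula τ n} → IsBigAnd φ → IsBigAnd ψ → BigAndDisjunction φ ψ
  disjunction = pull IsBigAnd (Renaming.rename-isBigAnd ⊆ᴸ-refl suc) λ a b →
    -- The first disjunct is now quantifier-free, so the second round takes the other one apart,
    -- with the two sides swapped.
    let θ , c , h = pull FinitaryQuantifierFree (Renaming.rename-quantifierFree ⊆ᴸ-refl suc)
                      (λ a b → _ , qf (or a b) , λ M ρ → ⇔-id _) b a
    in θ , c , λ M ρ → mk⇔ swap swap ⇔-∘ h M ρ

-- Interpolation by a Henkin construction

-- An assignment `σ` gives values to the constants 0, 1, 2, .... The newest constant comes first, so
-- that a quantifier in front of a formula binds exactly this one.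
env : ∀ {A : Set} n → (ℕ → A) → Vec A n
env zero    σ = []
env (suc n) σ = σ n ∷ env n σ

infix 4 _≈[_]_
_≈[_]_ : ∀ {A : Set} → (ℕ → A) → ℕ → (ℕ → A) → Set
σ ≈[ n ] σ′ = ∀ c → c < n → σ c ≡ σ′ c

env-cong : ∀ {A : Set} n {σ σ′ : ℕ → A} → σ ≈[ n ] σ′ → env n σ ≡ env n σ′
env-cong zero    h = refl
env-cong (suc n) h = cong₂ _∷_ (h n (n<1+n n)) (env-cong n λ c p → h c (m<n⇒m<1+n p))

update : ∀ {A : Set} → (ℕ → A) → ℕ → A → ℕ → A
update σ n y c with c ≟ n
... | yes _ = y
... | no  _ = σ c

update-at : ∀ {A : Set} (σ : ℕ → A) n y → update σ n y n ≡ y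
update-at σ n y with n ≟ n
... | yes _ = refl
... | no ¬p = ⊥-elim (¬p refl)

update-below : ∀ {A : Set} (σ : ℕ → A) n y → σ ≈[ n ] update σ n y
update-below σ n y c c<n with c ≟ n
... | yes refl = ⊥-elim (<-irrefl refl c<n)
... | no _     = refl

env-update : ∀ {A : Set} n (σ : ℕ → A) y → env (suc n) (update σ n y) ≡ y ∷ env n σ
env-update n σ y = cong₂ _∷_ (update-at σ n y) (sym (env-cong n (update-below σ n y)))

-- Requirements and their fresh witnesses

module Requirements {Obj : Set₁} (carrier : Obj → Set) where

  Predicate : Set₁
  Predicate = ∀ X → (ℕ → carrier X) → Set

  _⊆_ : Predicate → Predicate → Set₁
  P ⊆ Q = ∀ X σ → P X σ → Q X σ

  Local : ℕ → Predicate → Set₁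
  Local n P = ∀ X {σ σ′} → σ ≈[ n ] σ′ → P X σ → P X σ′

  -- A covering of all assignments by cases, each with a witness `y`. The cases look only at
  -- constants below `bound`, so that any later constant is free to name `y`.
  record Requirement (I : Set) : Set₁ where
    field
      bound  : ℕ
      Option : I → ∀ X → (ℕ → carrier X) → carrier X → Set
      local  : ∀ i X {σ σ′} y → σ ≈[ bound ] σ′ → Option i X σ y → Option i X σ′ y
      total  : ∀ X σ → ∃[ i ] ∃[ y ] Option i X σ y

  open Requirement

  Meets : ∀ {I} → Requirement I → Predicate → Set₁
  Meets r P = ∃[ i ] ∃[ c ] (P ⊆ λ X σ → Option r i X σ (σ c))

  refine : ∀ {I} → Predicate → ℕ → Requirement I → I → Predicate
  refine P n r i X σ = P X σ × Option r i X σ (σ n)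

  Local-refine : ∀ {I P n} (r : Requirement I) i → bound r ≤ n → Local n P → Local (suc n) (refine P n r i)
  Local-refine {n = n} r i b≤n l X {σ} {σ′} h (p , o) =
    l X (λ c c<n → h c (m<n⇒m<1+n c<n)) p ,
    subst (Option r i X σ′) (h n (n<1+n n))
      (local r i X (σ n) (λ c c<b → h c (m<n⇒m<1+n (<-≤-trans c<b b≤n))) o)

  -- `P` and the options do not see constant `n`, which can therefore be given the witness as its
  -- new value.
  refine-total : ∀ {I P n} (r : Requirement I) → bound r ≤ n → Local n P → ∀ {X σ} → P X σ →
                 ∃[ i ] ∃[ y ] refine P n r i X (update σ n y)
  refine-total {n = n} r b≤n l {X} {σ} p with i , y , o ← total r X σ =
    i , y , l X (update-below σ n y) p ,
    subst (Option r i X _) (sym (update-at σ n y))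
      (local r i X y (λ c c<b → update-below σ n y c (<-≤-trans c<b b≤n)) o)

-- Inseparable pairs of classes

module Interpolation (em : ∀ {a} → ExcludedMiddle a) {τ τ* : Language} (ι : τ ⊆ᴸ τ*) where

  Expanded : Set₁
  Expanded = Σ (Structure τ) (Expansion ι)

  module L = Requirements {Expanded} (Structure.Carrier ∘ proj₁)
  module R = Requirements {Structure τ} Structure.Carrier

  Separable : ℕ → L.Predicate → R.Predicate → Set₁
  Separable n C D = Σ[ θ ∈ Formula τ n ] IsBigAnd θ ×
    (C L.⊆ λ (M , _) σ → M [ env n σ ]⊨ θ) × (D R.⊆ λ M σ → ¬ M [ env n σ ]⊨ θ)

  -- An assignment in `C` can be changed at constant `n` so as to lie in one of the two refinements,
  -- and thus satisfies `∃ (θ₀ ∨ θ₁)`. As `D` does not see constant `n`, every such change of an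
  -- assignment in `D` stays in `D` and falsifies both `θ₀` and `θ₁`.
  separable-left : ∀ {n C D} (r : L.Requirement (Fin 2)) → L.Requirement.bound r ≤ n →
                   L.Local n C → R.Local n D →
                   (∀ i → Separable (suc n) (L.refine C n r i) D) → Separable n C D
  separable-left {n} {C} {D} r b≤n lC lD sep
    with θ , b , h ← Disjunction.disjunction em (proj₁ (proj₂ (sep zero))) (proj₁ (proj₂ (sep (suc zero)))) =
    ex θ , ex b , above , below
    where
    above : C L.⊆ λ (M , _) σ → M [ env n σ ]⊨ ex θ
    above X@(M , _) σ p with L.refine-total r b≤n lC p
    ... | zero , y , q = y , subst (M [_]⊨ θ) (env-update n σ y)
                               (Equivalence.from (h M _) (inj₁ (proj₁ (proj₂ (proj₂ (sep zero))) X _ q)))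
    ... | suc zero , y , q = y , subst (M [_]⊨ θ) (env-update n σ y)
                               (Equivalence.from (h M _) (inj₂ (proj₁ (proj₂ (proj₂ (sep (suc zero)))) X _ q)))
    below : D R.⊆ λ M σ → ¬ M [ env n σ ]⊨ ex θ
    below M σ p (y , s)
      with p′ ← lD M (update-below σ n y) p
      with Equivalence.to (h M _) (subst (M [_]⊨ θ) (sym (env-update n σ y)) s)
    ... | inj₁ u = proj₂ (proj₂ (proj₂ (sep zero))) M _ p′ u
    ... | inj₂ v = proj₂ (proj₂ (proj₂ (sep (suc zero)))) M _ p′ v

  -- Dually, every change at constant `n` stays in `C` and satisfies all `θ i`, while some change of
  -- an assignment in `D` enters a refinement and falsifies its `θ i`.
  separable-right : ∀ {n C D} (r : R.Requirement ℕ) → R.Requirement.bound r ≤ n →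
                    L.Local n C → R.Local n D →
                    (∀ i → Separable (suc n) C (R.refine D n r i)) → Separable n C D
  separable-right {n} {C} {D} r b≤n lC lD sep = all (⋀ θ) , all (⋀ λ i → proj₁ (proj₂ (sep i))) , above , below
    where
    θ : ℕ → Formula τ (suc n)
    θ i = proj₁ (sep i)
    above : C L.⊆ λ (M , _) σ → M [ env n σ ]⊨ all (⋀ θ)
    above X@(M , _) σ p y i = subst (M [_]⊨ θ i) (env-update n σ y)
      (proj₁ (proj₂ (proj₂ (sep i))) X _ (lC X (update-below σ n y) p))
    below : D R.⊆ λ M σ → ¬ M [ env n σ ]⊨ all (⋀ θ)
    below M σ p s with i , y , q ← R.refine-total r b≤n lD p =
      proj₂ (proj₂ (proj₂ (sep i))) M _ q (subst (M [_]⊨ θ i) (sym (env-update n σ y)) (s y i))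

  -- Quantify the extra constant existentially: on the left its own value is a witness, and on the
  -- right `D` does not see it.
  separable-shrink : ∀ {n C D} → R.Local n D → Separable (suc n) C D → Separable n C D
  separable-shrink {n} lD (θ , b , above , below) = ex θ , ex b ,
    (λ X σ p → σ n , above X σ p) ,
    (λ M σ p (y , s) → below M _ (lD M (update-below σ n y) p) (subst (M [_]⊨ θ) (sym (env-update n σ y)) s))

  record State : Set₁ where
    field
      size        : ℕ
      C           : L.Predicate
      D           : R.Predicate
      C-local     : L.Local size C
      D-local     : R.Local size D
      inseparable : ¬ Separable size C D

  open State

  infix 4 _≼_
  -- The smaller state is the later one, with more constants in use and smaller classes.
  record _≼_ (S S′ : State) : Set₁ where
    field
      size-≤ : size S′ ≤ size S
      C-⊆    : C S L.⊆ C S′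
      D-⊆    : D S R.⊆ D S′

  open _≼_

  ≼-refl : ∀ {S} → S ≼ S
  ≼-refl = record { size-≤ = ≤-refl ; C-⊆ = λ _ _ p → p ; D-⊆ = λ _ _ p → p }

  ≼-trans : ∀ {S S′ S″} → S ≼ S′ → S′ ≼ S″ → S ≼ S″
  ≼-trans a b = record
    { size-≤ = ≤-trans (size-≤ b) (size-≤ a)
    ; C-⊆    = λ X σ p → C-⊆ b X σ (C-⊆ a X σ p)
    ; D-⊆    = λ M σ p → D-⊆ b M σ (D-⊆ a M σ p)
    }

  -- The classes stay the same and only more constants count as used. This makes room for the bound
  -- of a requirement and drives the sizes to infinity.
  grow : ∀ m (S : State) → Σ[ S′ ∈ State ] S′ ≼ S × m ≤ size S′
  grow zero    S = S , ≼-refl , z≤n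
  grow (suc m) S with S′ , S′≼S , m≤ ← grow m S = record
      { size        = suc (size S′)
      ; C           = C S′
      ; D           = D S′
      ; C-local     = λ X h → C-local S′ X λ c c<n → h c (m<n⇒m<1+n c<n)
      ; D-local     = λ M h → D-local S′ M λ c c<n → h c (m<n⇒m<1+n c<n)
      ; inseparable = inseparable S′ ∘ separable-shrink (D-local S′)
      }
    , ≼-trans (record { size-≤ = n≤1+n _ ; C-⊆ = λ _ _ p → p ; D-⊆ = λ _ _ p → p }) S′≼S
    , s≤s m≤

  abstract
    -- If every option led to a separable pair, `separable-left` would separate the present one; so
    -- some option can be kept.
    step-left : ∀ (r : L.Requirement (Fin 2)) S → Σ[ S′ ∈ State ] S′ ≼ S × L.Meets r (C S′)
    step-left r S with S₁ , S₁≼S , b≤n ← grow (L.Requirement.bound r) S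
      with i , ¬sep ← ¬∀⇒∃¬ em (inseparable S₁ ∘ separable-left r b≤n (C-local S₁) (D-local S₁)) = record
        { size        = suc (size S₁)
        ; C           = L.refine (C S₁) (size S₁) r i
        ; D           = D S₁
        ; C-local     = L.Local-refine r i b≤n (C-local S₁)
        ; D-local     = λ M h → D-local S₁ M λ c c<n → h c (m<n⇒m<1+n c<n)
        ; inseparable = ¬sep
        }
      , ≼-trans (record { size-≤ = n≤1+n _ ; C-⊆ = λ _ _ → proj₁ ; D-⊆ = λ _ _ p → p }) S₁≼S
      , i , size S₁ , λ _ _ → proj₂

    step-right : ∀ (r : R.Requirement ℕ) S → Σ[ S′ ∈ State ] S′ ≼ S × R.Meets r (D S′)
    step-right r S with S₁ , S₁≼S , b≤n ← grow (R.Requirement.bound r) S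
      with i , ¬sep ← ¬∀⇒∃¬ em (inseparable S₁ ∘ separable-right r b≤n (C-local S₁) (D-local S₁)) = record
        { size        = suc (size S₁)
        ; C           = C S₁
        ; D           = R.refine (D S₁) (size S₁) r i
        ; C-local     = λ X h → C-local S₁ X λ c c<n → h c (m<n⇒m<1+n c<n)
        ; D-local     = R.Local-refine r i b≤n (D-local S₁)
        ; inseparable = ¬sep
        }
      , ≼-trans (record { size-≤ = n≤1+n _ ; C-⊆ = λ _ _ p → p ; D-⊆ = λ _ _ → proj₁ }) S₁≼S
      , i , size S₁ , λ _ _ → proj₂

    step : ∀ m (l : L.Requirement (Fin 2)) (r : R.Requirement ℕ) S →
           Σ[ S′ ∈ State ] S′ ≼ S × m ≤ size S′ × L.Meets l (C S′) × R.Meets r (D S′)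
    step m l r S
      with S₁ , S₁≼S , m≤ ← grow m S
      with S₂ , S₂≼S₁ , i , c , metL ← step-left l S₁
      with S₃ , S₃≼S₂ , metR ← step-right r S₂ =
        S₃ , ≼-trans S₃≼S₂ (≼-trans S₂≼S₁ S₁≼S)
      , ≤-trans m≤ (≤-trans (size-≤ S₂≼S₁) (size-≤ S₃≼S₂))
      -- The left requirement stays met while the later steps shrink the classes.
      , (i , c , λ X σ p → metL X σ (C-⊆ S₃≼S₂ X σ p)) , metR

  module Chain (l : ℕ → L.Requirement (Fin 2)) (r : ℕ → R.Requirement ℕ) (S₀ : State) where

    chain : ℕ → State
    chain zero    = S₀
    chain (suc k) = proj₁ (step (suc k) (l k) (r k) (chain k))

    -- Hence any finitely many constants are eventually available to separating formulas.
    chain-size : ∀ k → k ≤ size (chain k)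
    chain-size zero    = z≤n
    chain-size (suc k) = proj₁ (proj₂ (proj₂ (step (suc k) (l k) (r k) (chain k))))

    chain-≼ : ∀ {j k} → j ≤ k → chain k ≼ chain j
    chain-≼ {j} {k} j≤k = go (≤⇒≤′ j≤k)
      where
      go : ∀ {k} → j ≤′ k → chain k ≼ chain j
      go ≤′-refl           = ≼-refl
      go (≤′-step {k} j≤k) = ≼-trans (proj₁ (proj₂ (step (suc k) (l k) (r k) (chain k)))) (go j≤k)

    chain-left : ∀ k → L.Meets (l k) (C (chain (suc k)))
    chain-left k = proj₁ (proj₂ (proj₂ (proj₂ (step (suc k) (l k) (r k) (chain k)))))

    chain-right : ∀ k → R.Meets (r k) (D (chain (suc k)))
    chain-right k = proj₂ (proj₂ (proj₂ (proj₂ (step (suc k) (l k) (r k) (chain k)))))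

-- Truth and forcing

-- Made total for uniformity: atomic formulas are their own children, and surplus indices repeat a
-- branch. Paths of numbers then reach all subformulas, which are thereby countably many.
child : ∀ {τ} → ℕ → ∃ (Formula τ) → ∃ (Formula τ)
child i       (n , s ≈ t)    = n , s ≈ t
child i       (n , rel R ts) = n , rel R ts
child i       (n , neg φ)    = n , φ
child zero    (n , φ ∧ ψ)    = n , φ
child (suc _) (n , φ ∧ ψ)    = n , ψ
child zero    (n , φ ∨ ψ)    = n , φ
child (suc _) (n , φ ∨ ψ)    = n , ψ
child i       (n , ex φ)     = suc n , φ
child i       (n , all φ)    = suc n , φ
child i       (n , ⋀ φs)     = n , φs i
child i       (n , ⋁ φs)     = n , φs i

descend : ∀ {τ} → ∃ (Formula τ) → List ℕ → ∃ (Formula τ)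
descend = foldl (flip child)

descend-firstOrder : ∀ {τ} {φ : ∃ (Formula τ)} p → FirstOrder (proj₂ φ) → FirstOrder (proj₂ (descend φ p))
descend-firstOrder []      a = a
descend-firstOrder (i ∷ p) a = descend-firstOrder p (child-firstOrder i a)
  where
  child-firstOrder : ∀ {τ} {φ : ∃ (Formula τ)} i → FirstOrder (proj₂ φ) → FirstOrder (proj₂ (child i φ))
  child-firstOrder i       (eq s t)   = eq s t
  child-firstOrder i       (rel R ts) = rel R ts
  child-firstOrder i       (neg a)    = a
  child-firstOrder zero    (and a b)  = a
  child-firstOrder (suc _) (and a b)  = b
  child-firstOrder zero    (or a b)   = a
  child-firstOrder (suc _) (or a b)   = b
  child-firstOrder i       (ex a)     = a
  child-firstOrder i       (all a)    = a

-- The options i = 0, 1, … and witnesses y for settling φ.  An infinitary φ needs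
-- infinitely many options, a first-order one only the options 0 and 1.
Choice : ∀ {τ n} (M : Structure τ) → Formula τ n → ℕ → Vec (Structure.Carrier M) n → Structure.Carrier M → Set
Choice M (ex φ)  zero    ρ y = ¬ M [ ρ ]⊨ ex φ
Choice M (ex φ)  (suc _) ρ y = M [ y ∷ ρ ]⊨ φ
Choice M (all φ) zero    ρ y = M [ ρ ]⊨ all φ
Choice M (all φ) (suc _) ρ y = ¬ M [ y ∷ ρ ]⊨ φ
Choice M (⋀ φs)  zero    ρ y = M [ ρ ]⊨ ⋀ φs
Choice M (⋀ φs)  (suc i) ρ y = ¬ M [ ρ ]⊨ φs i
Choice M (⋁ φs)  zero    ρ y = ¬ M [ ρ ]⊨ ⋁ φs
Choice M (⋁ φs)  (suc i) ρ y = M [ ρ ]⊨ φs i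
Choice M φ       zero    ρ y = ¬ M [ ρ ]⊨ φ
Choice M φ       (suc _) ρ y = M [ ρ ]⊨ φ

-- Only a false `⋀` or a true `⋁` has to name a branch and may exceed index 1; these formulas are
-- not first-order.
choice-total : (∀ {a} → ExcludedMiddle a) → ∀ {τ n} (M : Structure τ) (φ : Formula τ n) ρ →
               ∃[ i ] ∃[ y ] Choice M φ i ρ y × (FirstOrder φ → i < 2)
choice-total em M φ ρ = go φ (em {P = M [ ρ ]⊨ φ})
  where
  y : Structure.Carrier M
  -- The default wherever `Choice` ignores the witness.
  y = Structure.inhabitant M

  0<2 : 0 < 2
  0<2 = s≤s z≤n

  1<2 : 1 < 2
  1<2 = s≤s (s≤s z≤n)

  go : ∀ φ → Dec (M [ ρ ]⊨ φ) → ∃[ i ] ∃[ y ] Choice M φ i ρ y × (FirstOrder φ → i < 2)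
  go (s ≈ t)    (yes p)       = 1 , y , p , λ _ → 1<2
  go (s ≈ t)    (no ¬p)       = 0 , y , ¬p , λ _ → 0<2
  go (rel R ts) (yes p)       = 1 , y , p , λ _ → 1<2
  go (rel R ts) (no ¬p)       = 0 , y , ¬p , λ _ → 0<2
  go (neg φ)    (yes p)       = 1 , y , p , λ _ → 1<2
  go (neg φ)    (no ¬p)       = 0 , y , ¬p , λ _ → 0<2
  go (φ ∧ ψ)    (yes p)       = 1 , y , p , λ _ → 1<2
  go (φ ∧ ψ)    (no ¬p)       = 0 , y , ¬p , λ _ → 0<2
  go (φ ∨ ψ)    (yes p)       = 1 , y , p , λ _ → 1<2
  go (φ ∨ ψ)    (no ¬p)       = 0 , y , ¬p , λ _ → 0<2
  go (ex φ)     (yes (a , p)) = 1 , a , p , λ _ → 1<2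
  go (ex φ)     (no ¬p)       = 0 , y , ¬p , λ _ → 0<2
  go (all φ)    (yes p)       = 0 , y , p , λ _ → 0<2
  go (all φ)    (no ¬p)       = let a , q = ¬∀⇒∃¬ em ¬p in 1 , a , q , λ _ → 1<2
  go (⋀ φs)     (yes p)       = 0 , y , p , λ _ → 0<2
  go (⋀ φs)     (no ¬p)       = let i , q = ¬∀⇒∃¬ em ¬p in suc i , y , q , λ ()
  go (⋁ φs)     (yes (i , p)) = suc i , y , p , λ ()
  go (⋁ φs)     (no ¬p)       = 0 , y , ¬p , λ _ → 0<2

strictBound : ∀ {k} → Vec ℕ k → ℕ
strictBound []       = 0
strictBound (c ∷ cs) = suc c ⊔ strictBound cs

lookup<strictBound : ∀ {k} (cs : Vec ℕ k) i → lookup cs i < strictBound cs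
lookup<strictBound (c ∷ cs) zero    = m≤m⊔n (suc c) (strictBound cs)
lookup<strictBound (c ∷ cs) (suc i) = ≤-trans (lookup<strictBound cs i) (m≤n⊔m (suc c) (strictBound cs))

map-local : ∀ {A : Set} {k} (cs : Vec ℕ k) {σ σ′ : ℕ → A} → σ ≈[ strictBound cs ] σ′ → map σ cs ≡ map σ′ cs
map-local []       h = refl
map-local (c ∷ cs) h = cong₂ _∷_ (h c (m≤m⊔n (suc c) (strictBound cs)))
  (map-local cs λ d p → h d (≤-trans p (m≤n⊔m (suc c) (strictBound cs))))

-- Serves both sides: on the left the objects are expansions, seen as structures of the large
-- language; on the right they are `τ`-structures.
module Forcing {τ : Language} {Obj : Set₁} (str : Obj → Structure τ) where

  open Requirements {Obj} (Structure.Carrier ∘ str) public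

  ⟦_⟧ : ∀ {n} → Formula τ n → Vec ℕ n → Predicate
  ⟦ φ ⟧ cs X σ = str X [ map σ cs ]⊨ φ

  ∁ : Predicate → Predicate
  ∁ P X σ = ¬ P X σ

  choiceRequirement : ∀ {n} {I : Set} (φ : Formula τ n) → Vec ℕ n → (index : I → ℕ) →
                      (∀ M ρ → ∃[ i ] ∃[ y ] Choice M φ (index i) ρ y) → Requirement I
  choiceRequirement φ cs index total = record
    { bound  = strictBound cs
    ; Option = λ i X σ y → Choice (str X) φ (index i) (map σ cs) y
    ; local  = λ i X y h → subst (λ ρ → Choice (str X) φ (index i) ρ y) (map-local cs h)
    ; total  = λ X σ → total (str X) (map σ cs)
    }

  binaryRequirement : (∀ {a} → ExcludedMiddle a) → ∀ {n} {φ : Formula τ n} → FirstOrder φ → Vec ℕ n →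
                      Requirement (Fin 2)
  binaryRequirement em {φ = φ} a cs = choiceRequirement φ cs toℕ λ M ρ →
    let i , y , p , <2 = choice-total em M φ ρ
    in fromℕ< (<2 a) , y , subst (λ i → Choice M φ i ρ y) (sym (toℕ-fromℕ< (<2 a))) p

  infinitaryRequirement : (∀ {a} → ExcludedMiddle a) → ∀ {n} → Formula τ n → Vec ℕ n → Requirement ℕ
  infinitaryRequirement em φ cs = choiceRequirement φ cs id λ M ρ →
    let i , y , p , _ = choice-total em M φ ρ in i , y , p

  module Generic (em : ∀ {a} → ExcludedMiddle a) (P : ℕ → Predicate)
                 (antitone : ∀ {j k} → j ≤ k → P k ⊆ P j)
                 (nonempty : ∀ k → ¬ (P k ⊆ λ _ _ → ⊥)) where

    Forces : Predicate → Set₁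
    Forces Q = ∃[ k ] (P k ⊆ Q)

    forces-map : ∀ {Q R} → Q ⊆ R → Forces Q → Forces R
    forces-map f (k , q) = k , λ X σ p → f X σ (q X σ p)

    -- The stages decrease, so the later of two stages forces both premises.
    forces-map₂ : ∀ {Q R S : Predicate} → (∀ X σ → Q X σ → R X σ → S X σ) → Forces Q → Forces R → Forces S
    forces-map₂ f (j , q) (k , r) = j ⊔ k , λ X σ p →
      f X σ (q X σ (antitone (m≤m⊔n j k) X σ p)) (r X σ (antitone (m≤n⊔m j k) X σ p))

    consistent : ∀ {Q} → Forces Q → ¬ Forces (∁ Q)
    consistent a b with k , f ← forces-map₂ {S = λ _ _ → ⊥} (λ X σ q ¬q → ¬q q) a b = nonempty k f

    Chosen : ∃ (Formula τ) → Set₁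
    Chosen (n , φ) = ∀ cs → ∃[ i ] ∃[ c ] Forces λ X σ → Choice (str X) φ i (map σ cs) (σ c)

    module Truth (N : Structure τ) (name : ℕ → Structure.Carrier N) (named : ∀ a → ∃[ c ] name c ≡ a) where

      Decided : ∀ {n} → Formula τ n → Set₁
      Decided φ = ∀ cs → (N [ map name cs ]⊨ φ → Forces (⟦ φ ⟧ cs)) ×
                         (¬ N [ map name cs ]⊨ φ → Forces (∁ (⟦ φ ⟧ cs)))

      module _ (decided-eq  : ∀ {n} (s t : Term τ n) → Chosen (n , s ≈ t) → Decided (s ≈ t))
               (decided-rel : ∀ {n k} (R : Rel τ k) (ts : Vec (Term τ n) k) →
                              Chosen (n , rel R ts) → Decided (rel R ts))
               where

        decided : ∀ {n} (φ : Formula τ n) → (∀ p → Chosen (descend (n , φ) p)) → Decided φ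
        decided (s ≈ t)    h = decided-eq s t (h [])
        decided (rel R ts) h = decided-rel R ts (h [])
        decided (neg φ)    h cs with sat , unsat ← decided φ (h ∘ (0 ∷_)) cs = unsat , λ ¬¬s →
          case em {P = N [ map name cs ]⊨ φ} of λ where
            (yes s) → forces-map (λ _ _ p ¬p → ¬p p) (sat s)
            (no ¬s) → ⊥-elim (¬¬s ¬s)
        decided (φ ∧ ψ) h cs
          with sat , unsat ← decided φ (h ∘ (0 ∷_)) cs
          with sat′ , unsat′ ← decided ψ (h ∘ (1 ∷_)) cs =
          (λ (s , t) → forces-map₂ (λ _ _ → _,_) (sat s) (sat′ t)) ,
          λ ¬st → case em {P = N [ map name cs ]⊨ φ} of λ where
            (yes s) → forces-map (λ _ _ ¬q (p , q) → ¬q q) (unsat′ λ t → ¬st (s , t))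
            (no ¬s) → forces-map (λ _ _ ¬p (p , q) → ¬p p) (unsat ¬s)
        decided (φ ∨ ψ) h cs
          with sat , unsat ← decided φ (h ∘ (0 ∷_)) cs
          with sat′ , unsat′ ← decided ψ (h ∘ (1 ∷_)) cs =
          (λ where
            (inj₁ s) → forces-map (λ _ _ → inj₁) (sat s)
            (inj₂ t) → forces-map (λ _ _ → inj₂) (sat′ t)) ,
          λ ¬st → forces-map₂ (λ _ _ ¬p ¬q → λ { (inj₁ p) → ¬p p ; (inj₂ q) → ¬q q })
                    (unsat (¬st ∘ inj₁)) (unsat′ (¬st ∘ inj₂))
        decided (ex φ) h cs = sat , unsat
          where
          IH : Decided φ
          IH = decided φ (h ∘ (0 ∷_))
          sat : N [ map name cs ]⊨ ex φ → Forces (⟦ ex φ ⟧ cs)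
          sat (a , s) with c , refl ← named a = forces-map (λ _ σ p → σ c , p) (proj₁ (IH (c ∷ cs)) s)
          unsat : ¬ N [ map name cs ]⊨ ex φ → Forces (∁ (⟦ ex φ ⟧ cs))
          unsat ¬s with h [] cs
          ... | zero  , c , f = f
          ... | suc _ , c , f = ⊥-elim (consistent f (proj₂ (IH (c ∷ cs)) λ s → ¬s (name c , s)))
        decided (all φ) h cs = sat , unsat
          where
          IH : Decided φ
          IH = decided φ (h ∘ (0 ∷_))
          sat : N [ map name cs ]⊨ all φ → Forces (⟦ all φ ⟧ cs)
          sat s with h [] cs
          ... | zero  , c , f = f
          ... | suc _ , c , f = ⊥-elim (consistent (proj₁ (IH (c ∷ cs)) (s (name c))) f)
          unsat : ¬ N [ map name cs ]⊨ all φ → Forces (∁ (⟦ all φ ⟧ cs))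
          unsat ¬s with a , ¬t ← ¬∀⇒∃¬ em ¬s with c , refl ← named a =
            forces-map (λ _ σ ¬p p → ¬p (p (σ c))) (proj₂ (IH (c ∷ cs)) ¬t)
        decided (⋀ φs) h cs = sat , unsat
          where
          IH : ∀ i → Decided (φs i)
          IH i = decided (φs i) (h ∘ (i ∷_))
          sat : N [ map name cs ]⊨ ⋀ φs → Forces (⟦ ⋀ φs ⟧ cs)
          sat s with h [] cs
          ... | zero  , c , f = f
          ... | suc i , c , f = ⊥-elim (consistent (proj₁ (IH i cs) (s i)) f)
          unsat : ¬ N [ map name cs ]⊨ ⋀ φs → Forces (∁ (⟦ ⋀ φs ⟧ cs))
          unsat ¬s with i , ¬t ← ¬∀⇒∃¬ em ¬s = forces-map (λ _ _ ¬p p → ¬p (p i)) (proj₂ (IH i cs) ¬t)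
        decided (⋁ φs) h cs = sat , unsat
          where
          IH : ∀ i → Decided (φs i)
          IH i = decided (φs i) (h ∘ (i ∷_))
          sat : N [ map name cs ]⊨ ⋁ φs → Forces (⟦ ⋁ φs ⟧ cs)
          sat (i , s) = forces-map (λ _ _ p → i , p) (proj₁ (IH i cs) s)
          unsat : ¬ N [ map name cs ]⊨ ⋁ φs → Forces (∁ (⟦ ⋁ φs ⟧ cs))
          unsat ¬s with h [] cs
          ... | zero  , c , f = f
          ... | suc i , c , f = ⊥-elim (consistent f (proj₂ (IH i cs) λ s → ¬s (i , s)))

    module Canonical (chosen : ∀ {n} {φ : Formula τ n} → FirstOrder φ → Chosen (n , φ)) where

      _~_ : ℕ → ℕ → Set₁
      c ~ d = Forces λ X σ → σ c ≡ σ d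

      least : ∀ {Q : ℕ → Set₁} n → Q n → ∃[ m ] Q m × (∀ j → Q j → m ≤ j)
      least {Q} n q with em {P = Q 0}
      ... | yes q₀ = 0 , q₀ , λ _ _ → z≤n
      least {Q} zero    q | no ¬q₀ = ⊥-elim (¬q₀ q)
      least {Q} (suc n) q | no ¬q₀ with m , r , min ← least {Q ∘ suc} n q =
        suc m , r , λ { zero q₀ → ⊥-elim (¬q₀ q₀) ; (suc j) q′ → s≤s (min j q′) }

      representative : ∀ c → ∃[ d ] c ~ d × (∀ e → c ~ e → d ≤ e)
      representative c = least c (0 , λ _ _ _ → refl)

      rep : ℕ → ℕ
      rep c = proj₁ (representative c)

      ~-rep : ∀ c → c ~ rep c
      ~-rep c = proj₁ (proj₂ (representative c))

      rep-cong : ∀ {c d} → c ~ d → rep c ≡ rep d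
      rep-cong {c} {d} c~d = ≤-antisym
        (proj₂ (proj₂ (representative c)) (rep d) (forces-map₂ (λ _ _ → trans) c~d (~-rep d)))
        (proj₂ (proj₂ (representative d)) (rep c) (forces-map₂ (λ _ _ p → trans (sym p)) c~d (~-rep c)))

      -- The least constants of their classes, which avoids a quotient.
      Element : Set
      Element = ∃[ c ] rep c ≡ c

      element-≡ : ∀ {a b : Element} → proj₁ a ≡ proj₁ b → a ≡ b
      element-≡ {c , p} {.c , q} refl = cong (c ,_) (≡-irrelevant p q)

      name : ℕ → Element
      name c = rep c , sym (rep-cong (~-rep c))

      name-proj₁ : ∀ a → name (proj₁ a) ≡ a
      name-proj₁ (c , p) = element-≡ p

      value : ∀ {k} (f : Fun τ k) cs → ∃[ d ] Forces λ X σ → Structure.fun (str X) f (map σ cs) ≡ σ d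
      value {k} f cs with chosen {φ = ex (app f (map var (tabulate suc)) ≈ var zero)} (ex (eq _ _)) cs
      ... | zero  , c , g =
        ⊥-elim (consistent (0 , λ X σ _ → _ , cong (Structure.fun (str X) f) (evals-shifted _ _ _)) g)
      ... | suc _ , c , g = c , forces-map (λ X σ → trans (cong (Structure.fun (str X) f)
        (sym (evals-shifted (Structure.interpretation (str X)) (σ c) (map σ cs))))) g

      holds : ∀ {k} → Rel τ k → Vec ℕ k → Predicate
      holds R cs X σ = Structure.rel (str X) R (map σ cs)

      canonical : Structure τ
      canonical = record
        { Carrier        = Element
        ; inhabitant     = name 0
        ; interpretation = record
          { fun = λ f as → name (proj₁ (value f (map proj₁ as)))
          ; rel = λ R as → True (em {P = Forces (holds R (map proj₁ as))})
          }
        }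

      open Truth canonical name (λ a → proj₁ a , name-proj₁ a) public

      private
        module N = Structure canonical

      mutual
        forces-eval : ∀ {n} (t : Term τ n) cs → Forces λ X σ →
                      eval (Structure.interpretation (str X)) (map σ cs) t ≡
                      σ (proj₁ (eval N.interpretation (map name cs) t))
        forces-eval (var i) cs rewrite lookup-map i name cs =
          forces-map (λ X σ → trans (lookup-map i σ cs)) (~-rep (lookup cs i))
        forces-eval (app f ts) cs = forces-map₂ (λ X σ → trans)
          (forces-map₂ (λ X σ p q → trans (cong (Structure.fun (str X) f) p) q)
            (forces-evals ts cs) (proj₂ (value f _)))
          (~-rep _)

        forces-evals : ∀ {n k} (ts : Vec (Term τ n) k) cs → Forces λ X σ →
                       evals (Structure.interpretation (str X)) (map σ cs) ts ≡
                       map σ (map proj₁ (evals N.interpretation (map name cs) ts))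
        forces-evals []       cs = 0 , λ _ _ _ → refl
        forces-evals (t ∷ ts) cs = forces-map₂ (λ _ _ → cong₂ _∷_) (forces-eval t cs) (forces-evals ts cs)

      canonical-eq : ∀ {n} (s t : Term τ n) → Chosen (n , s ≈ t) → Decided (s ≈ t)
      canonical-eq s t choose cs =
        (λ s≡t → forces-map₂ (λ X σ p q → trans p (trans (cong (σ ∘ proj₁) s≡t) (sym q)))
                   (forces-eval s cs) (forces-eval t cs)) ,
        λ s≢t → case choose cs of λ where
          (zero  , _ , g) → g
          (suc _ , _ , g) → ⊥-elim (s≢t (element-≡ (
            trans (sym (proj₂ (eval N.interpretation (map name cs) s)))
              (trans (rep-cong (forces-map₂ (λ _ _ → trans)
                        (forces-map₂ (λ _ _ p q → trans (sym p) q) (forces-eval s cs) g) (forces-eval t cs)))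
                (proj₂ (eval N.interpretation (map name cs) t))))))

      canonical-rel : ∀ {n k} (R : Rel τ k) (ts : Vec (Term τ n) k) → Chosen (n , rel R ts) → Decided (rel R ts)
      canonical-rel R ts choose cs =
        (λ h → forces-map₂ (λ X σ p → subst (Structure.rel (str X) R) (sym p))
                 (forces-evals ts cs) (toWitness h)) ,
        λ ¬h → case choose cs of λ where
          (zero  , _ , g) → g
          (suc _ , _ , g) → ⊥-elim (¬h (fromWitness (forces-map₂ (λ X σ p → subst (Structure.rel (str X) R) p)
                                         (forces-evals ts cs) g)))

    record TermModel : Set₁ where
      field
        model : Structure τ
        name  : ℕ → Structure.Carrier model
        named : ∀ a → ∃[ c ] name c ≡ a
      open Truth model name named public
      field
        decides : ∀ {n} {φ : Formula τ n} → FirstOrder φ → Decided φ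

    abstract
      termModel : (∀ {n} {φ : Formula τ n} → FirstOrder φ → Chosen (n , φ)) → TermModel
      termModel chosen = record
        { model   = canonical
        ; name    = name
        ; named   = λ a → proj₁ a , name-proj₁ a
        ; decides = λ {_} {φ} a → decided canonical-eq canonical-rel φ λ p → chosen (descend-firstOrder p a)
        }
        where open Canonical chosen

lookup-env : ∀ n {c} → c < n → Σ[ i ∈ Fin n ] (∀ {A : Set} (σ : ℕ → A) → lookup (env n σ) i ≡ σ c)
lookup-env (suc n) c<1+n with m<1+n⇒m<n∨m≡n c<1+n
... | inj₁ c<n  = let i , p = lookup-env n c<n in suc i , p
... | inj₂ refl = zero , λ _ → refl

module _ (em : ∀ {a} → ExcludedMiddle a) {τ τ* : Language} (ι : τ ⊆ᴸ τ*) (countable* : CountableLanguage τ*)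
         (T : FirstOrderTheory τ*) (φ₀ : Sentence τ)
         (entails : ∀ M (E : Expansion ι M) → Expansion.structure* E ⊨ᵀ T → M ⊨ φ₀) where

  open Interpolation em ι
  private
    module FL = Forcing {τ*} {Expanded} (λ X → Expansion.structure* (proj₂ X))
    module FR = Forcing {τ} {Structure τ} id

  abstract
    leftEnumeration : ℕ ↠ ∃ λ n → ∃ (FirstOrder {τ*} {n}) × Vec ℕ n
    leftEnumeration = ∐ (↠-id ℕ) λ n → Serialisation.firstOrderFormulas countable* em n ⊗ vectors n

    rightEnumeration : ℕ ↠ ∃ λ p → Vec ℕ (proj₁ (descend (0 , φ₀) p))
    rightEnumeration = ∐ lists λ p → vectors (proj₁ (descend (0 , φ₀) p))

  initialC : L.Predicate
  initialC (M , E) σ = Expansion.structure* E ⊨ᵀ T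

  initialD : R.Predicate
  initialD M σ = ¬ M ⊨ φ₀

  leftRequirement : (∃ λ n → ∃ (FirstOrder {τ*} {n}) × Vec ℕ n) → L.Requirement (Fin 2)
  leftRequirement (n , (φ , a) , cs) = FL.binaryRequirement em a cs

  rightRequirement : (∃ λ p → Vec ℕ (proj₁ (descend (0 , φ₀) p))) → R.Requirement ℕ
  rightRequirement (p , cs) = FR.infinitaryRequirement em (proj₂ (descend (0 , φ₀) p)) cs

  open State using (size; C; D)

  module Contradiction
    (chain       : ℕ → State)
    (start-C     : C (chain 0) L.⊆ initialC)
    (start-D     : D (chain 0) R.⊆ initialD)
    (chain-size  : ∀ k → k ≤ size (chain k))
    (chain-≼     : ∀ {j k} → j ≤ k → chain k ≼ chain j)
    (chain-left  : ∀ k → L.Meets (leftRequirement (Surjection.to leftEnumeration k)) (C (chain (suc k))))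
    (chain-right : ∀ k → R.Meets (rightRequirement (Surjection.to rightEnumeration k)) (D (chain (suc k))))
    where

    C-nonempty : ∀ k → ¬ (C (chain k) L.⊆ λ _ _ → ⊥)
    C-nonempty k empty = State.inseparable (chain k) (falsum , ex (qf (neg (eq _ _))) ,
      (λ X σ p → ⊥-elim (empty X σ p)) , λ M σ p (a , a≢a) → a≢a refl)

    D-nonempty : ∀ k → ¬ (D (chain k) R.⊆ λ _ _ → ⊥)
    D-nonempty k empty = State.inseparable (chain k) (verum , ex (qf (eq _ _)) ,
      (λ X σ p → σ 0 , refl) , λ M σ p _ → empty M σ p)

    module GL = FL.Generic em (C ∘ chain) (λ j≤k → _≼_.C-⊆ (chain-≼ j≤k)) C-nonempty
    module GR = FR.Generic em (D ∘ chain) (λ j≤k → _≼_.D-⊆ (chain-≼ j≤k)) D-nonempty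

    chosenL : ∀ {n} {φ : Formula τ* n} → FirstOrder φ → GL.Chosen (n , φ)
    chosenL {n} {φ} a cs with k , p ← Surjection.strictlySurjective leftEnumeration (n , (φ , a) , cs)
      with i , c , h ← subst (λ x → L.Meets (leftRequirement x) (C (chain (suc k)))) p (chain-left k) =
      toℕ i , c , suc k , h

    chosenR : ∀ p → GR.Chosen (descend (0 , φ₀) p)
    chosenR p cs with k , q ← Surjection.strictlySurjective rightEnumeration (p , cs)
      with i , c , h ← subst (λ x → R.Meets (rightRequirement x) (D (chain (suc k)))) q (chain-right k) =
      i , c , suc k , h

    open GL.TermModel (GL.termModel chosenL)

    -- Otherwise α separates the two sides at a late enough stage.
    compatible : ∀ {n} {α : Formula τ n} → FinitaryQuantifierFree α → ∀ cs →
                 GL.Forces (FL.⟦ Renaming.rename ι id α ⟧ cs) → ¬ GR.Forces (FR.∁ (FR.⟦ α ⟧ cs))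
    compatible {n} {α} a cs (j , f) (k , g) = State.inseparable (chain m)
      (Renaming.rename ⊆ᴸ-refl index α , qf (Renaming.rename-quantifierFree ⊆ᴸ-refl index a) , above , below)
      where
      m : ℕ
      m = strictBound cs ⊔ (j ⊔ k)

      cs< : ∀ i → lookup cs i < size (chain m)
      cs< i = <-≤-trans (lookup<strictBound cs i) (≤-trans (m≤m⊔n _ (j ⊔ k)) (chain-size m))

      index : Fin n → Fin (size (chain m))
      index i = proj₁ (lookup-env (size (chain m)) (cs< i))

      lookup-index : ∀ {A : Set} (σ : ℕ → A) i → lookup (env (size (chain m)) σ) (index i) ≡ lookup (map σ cs) i
      lookup-index σ i = trans (proj₂ (lookup-env (size (chain m)) (cs< i)) σ) (sym (lookup-map i σ cs))

      above : C (chain m) L.⊆ λ (M , _) σ → M [ env (size (chain m)) σ ]⊨ Renaming.rename ⊆ᴸ-refl index α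
      above X@(M , E) σ p =
        Equivalence.from (Renaming.Sat-rename ⊆ᴸ-refl (trivialExpansion M) (lookup-index σ) α)
          (Equivalence.to (Renaming.Sat-translate ι E (map σ cs) α)
            (f X σ (_≼_.C-⊆ (chain-≼ (≤-trans (m≤m⊔n j k) (m≤n⊔m (strictBound cs) (j ⊔ k)))) X σ p)))

      below : D (chain m) R.⊆ λ M σ → ¬ M [ env (size (chain m)) σ ]⊨ Renaming.rename ⊆ᴸ-refl index α
      below M σ p s = g M σ (_≼_.D-⊆ (chain-≼ (≤-trans (m≤n⊔m j k) (m≤n⊔m (strictBound cs) (j ⊔ k)))) M σ p)
        (Equivalence.to (Renaming.Sat-rename ⊆ᴸ-refl (trivialExpansion M) (lookup-index σ) α) s)

    module TR = GR.Truth (reduct ι model) name named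

    literal : ∀ {n} {α : Formula τ n} → FinitaryQuantifierFree α →
              (∀ cs → GR.Forces (FR.⟦ α ⟧ cs) ⊎ GR.Forces (FR.∁ (FR.⟦ α ⟧ cs))) → TR.Decided α
    literal {α = α} a choose cs = sat , unsat
      where
      atModel : model [ map name cs ]⊨ Renaming.rename ι id α ⇔ reduct ι model [ map name cs ]⊨ α
      atModel = Renaming.Sat-translate ι (reductExpansion ι model) (map name cs) α

      a* : FirstOrder (Renaming.rename ι id α)
      a* = firstOrder (Renaming.rename-quantifierFree ι id a)

      sat : reduct ι model [ map name cs ]⊨ α → GR.Forces (FR.⟦ α ⟧ cs)
      sat s with choose cs
      ... | inj₁ f = f
      ... | inj₂ g = ⊥-elim (compatible a cs (proj₁ (decides a* cs) (Equivalence.from atModel s)) g)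

      unsat : ¬ reduct ι model [ map name cs ]⊨ α → GR.Forces (FR.∁ (FR.⟦ α ⟧ cs))
      unsat ¬s with choose cs
      ... | inj₁ f = ⊥-elim (compatible (neg a) cs (proj₂ (decides a* cs) (¬s ∘ Equivalence.to atModel))
                               (GR.forces-map (λ _ _ p ¬p → ¬p p) f))
      ... | inj₂ g = g

    decidedR : TR.Decided φ₀
    decidedR = TR.decided
      (λ s t choose → literal (eq s t) λ cs → case choose cs of λ where
        (zero  , _ , g) → inj₂ g
        (suc _ , _ , f) → inj₁ f)
      (λ R ts choose → literal (rel R ts) λ cs → case choose cs of λ where
        (zero  , _ , g) → inj₂ g
        (suc _ , _ , f) → inj₁ f)
      φ₀ chosenR

    model-⊨ᵀ : model ⊨ᵀ T
    model-⊨ᵀ φ ax with em {P = model ⊨ φ}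
    ... | yes s = s
    ... | no ¬s = ⊥-elim (GL.consistent (0 , λ X σ p → start-C X σ p φ ax)
                           (proj₂ (decides (FirstOrderTheory.firstOrder T ax) []) ¬s))

    contradiction : ⊥
    contradiction = GR.consistent
      (proj₁ (decidedR []) (entails (reduct ι model) (reductExpansion ι model) model-⊨ᵀ))
      (0 , start-D)

  interpolant : Σ[ θ ∈ Sentence τ ] IsBigAnd θ ×
                (∀ M (E : Expansion ι M) → Expansion.structure* E ⊨ᵀ T → M ⊨ θ) × (∀ M → M ⊨ θ → M ⊨ φ₀)
  interpolant with em {P = Separable 0 initialC initialD}
  ... | no inseparable = ⊥-elim (Contradiction.contradiction
          chain (λ _ _ p → p) (λ _ _ p → p) chain-size chain-≼ chain-left chain-right)
    where
    initial : State
    initial = record { size = 0 ; C = initialC ; D = initialD ; C-local = λ _ _ p → p ; D-local = λ _ _ p → p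
                     ; inseparable = inseparable }
    open Chain (leftRequirement ∘ Surjection.to leftEnumeration)
               (rightRequirement ∘ Surjection.to rightEnumeration) initial
  ... | yes (θ , b , above , below) = θ , b ,
    (λ M E h → above (M , E) (λ _ → Structure.inhabitant M) h) ,
    λ M s → case em {P = M ⊨ φ₀} of λ where
      (yes t) → t
      (no ¬t) → ⊥-elim (below M (λ _ → Structure.inhabitant M) ¬t s)

-- ⋀-sentences as first-order theories

close : ∀ {τ} n → Formula τ n → Sentence τ
close zero    φ = φ
close (suc n) φ = close n (all φ)

close-firstOrder : ∀ {τ} n {φ : Formula τ n} → FirstOrder φ → FirstOrder (close n φ)
close-firstOrder zero    a = a
close-firstOrder (suc n) a = close-firstOrder n (all a)

⊨-close : ∀ {τ} (M : Structure τ) n {φ : Formula τ n} → M ⊨ close n φ ⇔ (∀ ρ → M [ ρ ]⊨ φ)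
⊨-close M zero    = mk⇔ (λ { s [] → s }) (λ s → s [])
⊨-close M (suc n) = mk⇔ (λ s → λ { (a ∷ ρ) → Equivalence.to (⊨-close M n) s ρ a })
                        (λ s → Equivalence.from (⊨-close M n) λ ρ a → s (a ∷ ρ))

-- Paths list the branches taken from last to first.  The symbol named by a path p is
-- available in every arity, but matters only in that of node p.
module Naming {τ : Language} (φ₀ : Sentence τ) where

  expanded : Language
  expanded = record { Fun = Fun τ ; Rel = λ k → Rel τ k ⊎ List ℕ }

  expanded-countable : CountableLanguage τ → CountableLanguage expanded
  expanded-countable (funs , rels) = funs , mk↣ {to = code} λ {x} {y} → code-injective x y
    where
    code : Σ ℕ (Rel expanded) → ℕ
    code (k , inj₁ R) = encode pairs (0 , Injection.to rels (k , R))
    code (k , inj₂ p) = encode pairs (suc k , encode lists p)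

    code-injective : ∀ x y → code x ≡ code y → x ≡ y
    code-injective (k , inj₁ R) (l , inj₁ S) q
      with refl ← Injection.injective rels (,-injectiveʳ (encode-injective pairs q)) = refl
    code-injective (k , inj₁ R) (l , inj₂ p) q with () ← ,-injectiveˡ (encode-injective pairs q)
    code-injective (k , inj₂ p) (l , inj₁ S) q with () ← ,-injectiveˡ (encode-injective pairs q)
    code-injective (k , inj₂ p) (l , inj₂ p′) q
      with refl ← ,-injectiveˡ (encode-injective pairs {suc k , _} {suc l , _} q)
      with refl ← encode-injective lists {p} {p′}
                    (,-injectiveʳ (encode-injective pairs {suc k , _} {suc k , _} q)) = refl

  inclusion : τ ⊆ᴸ expanded
  inclusion = record { onFun = id ; onRel = inj₁ ; onFun-injective = id ; onRel-injective = inj₁-injective }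

  node : List ℕ → ∃ (Formula τ)
  node = foldr child (0 , φ₀)

  named : ∀ {n} → List ℕ → Formula expanded n
  named {n} p = rel (inj₂ p) (map var (allFin n))

  body : ∀ {n} → ℕ → List ℕ → Formula τ n → Formula expanded n
  body i p (ex φ)  = ex (named (i ∷ p))
  body i p (all φ) = all (named (i ∷ p))
  body i p (⋀ φs)  = named (i ∷ p)
  body i p φ       = Renaming.rename inclusion id φ

  body-quantifierFree : ∀ {n i p} {φ : Formula τ n} → FinitaryQuantifierFree φ →
                        body i p φ ≡ Renaming.rename inclusion id φ
  body-quantifierFree (eq s t)   = refl
  body-quantifierFree (rel R ts) = refl
  body-quantifierFree (neg a)    = refl
  body-quantifierFree (and a b)  = refl
  body-quantifierFree (or a b)   = refl

  implication : ℕ → List ℕ → ∃ (Formula τ) → Sentence expanded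
  implication i p (n , φ) = close n (neg (named p) ∨ body i p φ)

  theory : FirstOrderTheory expanded
  theory = record
    { Axiom      = λ χ → (χ ≡ named [] ⊎ ∃[ p ] ∃[ i ] χ ≡ implication i p (node p)) × FirstOrder χ
    ; firstOrder = proj₂
    }

  data SatAt (M : Structure τ) : ∃ (Formula τ) → ∀ {k} → Vec (Structure.Carrier M) k → Set where
    sat : ∀ {n} {φ : Formula τ n} {ρ} → M [ ρ ]⊨ φ → SatAt M (n , φ) ρ

  expand : ∀ M → Expansion inclusion M
  expand M = record
    { interpretation* = record
      { fun = Structure.fun M
      ; rel = λ { (inj₁ R) → Structure.rel M R ; (inj₂ p) → SatAt M (node p) }
      }
    ; fun-agrees = λ _ _ → refl
    ; rel-agrees = λ _ _ → ⇔-id _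
    }

  ⊨-named : ∀ {n} (N : Structure expanded) p (ρ : Vec _ n) → N [ ρ ]⊨ named p ⇔ Structure.rel N (inj₂ p) ρ
  ⊨-named N p ρ
    rewrite trans (evals-var (Structure.interpretation N) ρ (allFin _)) (map-lookup-allFin ρ) = ⇔-id _

  expand-⊨ᵀ : (∀ {a} → ExcludedMiddle a) → ∀ M → M ⊨ φ₀ → Expansion.structure* (expand M) ⊨ᵀ theory
  expand-⊨ᵀ em M s χ (inj₁ refl , _) = sat s
  expand-⊨ᵀ em M s χ (inj₂ (p , i , refl) , _) = Equivalence.from (⊨-close M* _) holds
    where
    M* : Structure expanded
    M* = Expansion.structure* (expand M)

    child-sat : ∀ {n} {φ : Formula τ n} {k} {ρ : Vec (Structure.Carrier M) k} → node p ≡ (n , φ) →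
                SatAt M (child i (n , φ)) ρ → M* [ ρ ]⊨ named (i ∷ p)
    child-sat {ρ = ρ} q h =
      Equivalence.from (⊨-named M* (i ∷ p) ρ) (subst (λ x → SatAt M (child i x) ρ) (sym q) h)

    body-sat : ∀ {n} (φ : Formula τ n) ρ → node p ≡ (n , φ) → M [ ρ ]⊨ φ → M* [ ρ ]⊨ body i p φ
    body-sat (ex φ)     ρ q (a , s) = a , child-sat q (sat s)
    body-sat (all φ)    ρ q s       = λ a → child-sat q (sat (s a))
    body-sat (⋀ φs)     ρ q s       = child-sat q (sat (s i))
    body-sat φ@(_ ≈ _)   ρ q s = Equivalence.from (Renaming.Sat-translate inclusion (expand M) ρ φ) s
    body-sat φ@(rel _ _) ρ q s = Equivalence.from (Renaming.Sat-translate inclusion (expand M) ρ φ) s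
    body-sat φ@(neg _)   ρ q s = Equivalence.from (Renaming.Sat-translate inclusion (expand M) ρ φ) s
    body-sat φ@(_ ∧ _)   ρ q s = Equivalence.from (Renaming.Sat-translate inclusion (expand M) ρ φ) s
    body-sat φ@(_ ∨ _)   ρ q s = Equivalence.from (Renaming.Sat-translate inclusion (expand M) ρ φ) s
    body-sat φ@(⋁ _)     ρ q s = Equivalence.from (Renaming.Sat-translate inclusion (expand M) ρ φ) s

    satAt⁻¹ : ∀ {x : ∃ (Formula τ)} {ρ} → SatAt M x {proj₁ x} ρ → M [ ρ ]⊨ proj₂ x
    satAt⁻¹ (sat s) = s

    holds : ∀ ρ → M* [ ρ ]⊨ (neg (named p) ∨ body i p (proj₂ (node p)))
    holds ρ with em {P = M* [ ρ ]⊨ named p}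
    ... | no ¬h = inj₁ ¬h
    ... | yes h = inj₂ (body-sat _ ρ refl (satAt⁻¹ (Equivalence.to (⊨-named M* p ρ) h)))

  module _ {M} (E : Expansion inclusion M) (h : Expansion.structure* E ⊨ᵀ theory) where
    private
      M* : Structure expanded
      M* = Expansion.structure* E

    named⇒body : ∀ {n} {φ : Formula τ n} i p → node p ≡ (n , φ) → FirstOrder (body i p φ) →
                 ∀ ρ → M* [ ρ ]⊨ named p → M* [ ρ ]⊨ body i p φ
    named⇒body {n} {φ} i p q a ρ s with Equivalence.to (⊨-close M* n)
      (h (implication i p (n , φ))
         (inj₂ (p , i , cong (implication i p) (sym q)) , close-firstOrder n (or (neg (rel _ _)) a))) ρ
    ... | inj₁ ¬s = ⊥-elim (¬s s)
    ... | inj₂ t  = t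

    named⇒sat : ∀ {n} {φ : Formula τ n} p → IsBigAnd φ → node p ≡ (n , φ) →
                ∀ ρ → M* [ ρ ]⊨ named p → M [ ρ ]⊨ φ
    named⇒sat {φ = φ} p (qf a) q ρ s = Equivalence.to (Renaming.Sat-translate inclusion E ρ φ)
      (subst (M* [ ρ ]⊨_) (body-quantifierFree a)
        (named⇒body 0 p q (subst FirstOrder (sym (body-quantifierFree a))
          (firstOrder (Renaming.rename-quantifierFree inclusion id a))) ρ s))
    named⇒sat p (ex b) q ρ s with a , t ← named⇒body 0 p q (ex (rel _ _)) ρ s =
      a , named⇒sat (0 ∷ p) b (cong (child 0) q) (a ∷ ρ) t
    named⇒sat p (all b) q ρ s a =
      named⇒sat (0 ∷ p) b (cong (child 0) q) (a ∷ ρ) (named⇒body 0 p q (all (rel _ _)) ρ s a)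
    named⇒sat p (⋀ bs) q ρ s i =
      named⇒sat (i ∷ p) (bs i) (cong (child i) q) ρ (named⇒body i p q (rel _ _) ρ s)

    ⊨ᵀ⇒⊨ : IsBigAnd φ₀ → M ⊨ φ₀
    ⊨ᵀ⇒⊨ b = named⇒sat [] b refl [] (h (named []) (inj₁ refl , rel _ _))

theorem1p1 : (∀ {a} → ExcludedMiddle a) →
    ∀ {ℓ} (τ : Language) → CountableLanguage τ →
    (K : Structure τ → Set ℓ) → ClosedUnderIsomorphism K →
    (IsPCΔ K × IsInfinitaryElementary K) ⇔ IsBigAndElementary K
theorem1p1 em τ countable K _ = mk⇔ forward backward
  where
  forward : IsPCΔ K × IsInfinitaryElementary K → IsBigAndElementary K
  forward ((τ* , countable* , ι , T , K⇔T) , φ , K⇔φ)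
    with θ , b , T⊨θ , θ⊨φ ← interpolant em ι countable* T φ
           (λ M E h → Equivalence.to (K⇔φ M) (Equivalence.from (K⇔T M) (E , h))) =
    θ , b , λ M → mk⇔
      (λ k → let E , h = Equivalence.to (K⇔T M) k in T⊨θ M E h)
      (λ s → Equivalence.from (K⇔φ M) (θ⊨φ M s))

  backward : IsBigAndElementary K → IsPCΔ K × IsInfinitaryElementary K
  backward (φ , b , K⇔φ) =
    (expanded , expanded-countable countable , inclusion , theory , λ M → mk⇔
      (λ k → expand M , expand-⊨ᵀ em M (Equivalence.to (K⇔φ M) k))
      (λ (E , h) → Equivalence.from (K⇔φ M) (⊨ᵀ⇒⊨ E h b))) ,
    φ , K⇔φ
    where open Naming φ
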